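{- Let $a, b \in \mathbb{Z}$ and let $\delta(a,b) = b^2 - 3ab + 9a^2$. Then the ternary cubic form $$G_{a,b}(x,y,z) = x^3 - \frac{\delta(a,b)\,(y^2 + yz + z^2)}{3}\, x - \frac{\delta(a,b)\left((3a - 2b) y^3 + 3(6a - b) y^2 z + 3(3a + b) y z^2 - (3a - 2b) z^3\right)}{27}$$ is canonically $\mathrm{SL}_3\left[\frac13\mathbb{Z}\right]$-equivalent to the cubicovariant $C_3$ of the pair $$(A_{a,b}, B_{a,b}) = \left(\begin{bmatrix} 0 & 0 & 1 \\ 0 & -a & 0 \\ 1 & 0 & -b + 3a \end{bmatrix}, \begin{bmatrix} 0 & 1 & 0 \\ 1 & b & 0 \\ 0 & 0 & -a \end{bmatrix}\right).$$
   Context: For a square matrix $M$, $M^\dagger$ denotes the adjugate matrix of $M$. For a pair $(A,B)$ of symmetric $3\times 3$ matrices put $$f_A(\mathbf{x}) = \mathbf{x}^t A\mathbf{x}, \quad f_B(\mathbf{x}) = \mathbf{x}^t B\mathbf{x}, \quad g_B(\mathbf{x}) = \mathbf{x}^t (A B^\dagger A)\mathbf{x}.$$ The cubicovariant $C_3(\mathbf{x})$ of $(A,B)$ is the Jacobian determinant of the three forms $f_A, f_B, g_B$, i.e. the determinant of the $3\times 3$ matrix whose rows are the gradients of $f_A$, $f_B$, $g_B$ in this order. Equivalence of two ternary cubic forms under $\mathrm{SL}_3\left[\frac13\mathbb{Z}\right]$ means that one is obtained from the other by a linear substitution of the variables by a $3\times 3$ matrix of determinant $1$ with entries in $\mathb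b{Z}\left[\frac13\right]$.
   Formalization: The cubicovariant is taken as 1/8 of the Jacobian determinant (gradients halved, rows Ax, Bx, AB†Ax); with plain gradients it is divisible by 8 while G(1,0,0)=1, so the claim fails for every a, b. "Canonically" is read as one substitution matrix over Z[1/3][a,b]. -}

module Defs where

open import Algebra.Bundles using (RawRing)
import Algebra.Definitions.RawSemiring as RawSemiringDefs
open import Data.Fin.Base using (Fin; zero; suc; toℕ; punchIn)
open import Data.Fin.Patterns using (0F; 1F; 2F)
open import Data.Integer.Base using (ℤ; +_)
open import Data.List.Base as List using (List; []; _∷_)
open import Data.List.Relation.Unary.All using (All)
open import Data.Nat.Base as ℕ using (ℕ; zero; suc)
open import Data.Product.Base using (Σ-syntax; ∃₂; _×_; _,_)
open import Data.Rational.Base as ℚ using (ℚ; 1ℚ; _/_; +-*-rawRing; +-*-rawSemiring)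
open import Data.Rational.Literals using (fromℤ)
open import Data.Vec.Functional as Vector using (Vector)
open import Function.Base using (id)
open import Level using (Level; 0ℓ)
open import Relation.Binary.PropositionalEquality using (_≡_)

module Matrices {c ℓ : Level} (R : RawRing c ℓ) where
  open RawRing R
  open RawSemiringDefs rawSemiring using (_^_; sum)

  Matrix : ℕ → Set c
  Matrix n = Fin n → Fin n → Carrier

  _⊗_ : ∀ {n} → Matrix n → Matrix n → Matrix n
  (M ⊗ N) i j = sum (λ k → M i k * N k j)

  minor : ∀ {n} → Matrix (suc n) → Fin (suc n) → Fin (suc n) → Matrix n
  minor M i j k l = M (punchIn i k) (punchIn j l)

  sign : ∀ {n} → Fin n → Fin n → Carrier
  sign i j = (- 1#) ^ (toℕ i ℕ.+ toℕ j)

  det : ∀ {n} → Matrix n → Carrier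
  det {zero}  M = 1#
  det {suc n} M = sum (λ j → sign zero j * (M zero j * det (minor M zero j)))

  adjugate : ∀ {n} → Matrix (suc n) → Matrix (suc n)
  adjugate M i j = sign j i * det (minor M j i)

-- R[X], a polynomial being its list of coefficients, constant term first.
-- Lists differing only by trailing zeros are identified by _≈ₚ_.

module Univariate {c ℓ : Level} (R : RawRing c ℓ) where
  open RawRing R

  coefficient : List Carrier → ℕ → Carrier
  coefficient []      _       = 0#
  coefficient (a ∷ p) zero    = a
  coefficient (a ∷ p) (suc k) = coefficient p k

  infix  4 _≈ₚ_
  infixl 6 _+ₚ_
  infixl 7 _*ₚ_

  _≈ₚ_ : List Carrier → List Carrier → Set ℓ
  p ≈ₚ q = ∀ k → coefficient p k ≈ coefficient q k

  _+ₚ_ : List Carrier → List Carrier → List Carrier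
  []      +ₚ q       = q
  (a ∷ p) +ₚ []      = a ∷ p
  (a ∷ p) +ₚ (b ∷ q) = (a + b) ∷ (p +ₚ q)

  _*ₚ_ : List Carrier → List Carrier → List Carrier
  []      *ₚ q = []
  (a ∷ p) *ₚ q = List.map (a *_) q +ₚ (0# ∷ (p *ₚ q))

  -- (a + X p)′ = p + X p′
  derivative : List Carrier → List Carrier
  derivative []      = []
  derivative (a ∷ p) = p +ₚ (0# ∷ derivative p)

  polynomialRing : RawRing c ℓ
  polynomialRing = record
    { Carrier = List Carrier
    ; _≈_     = _≈ₚ_
    ; _+_     = _+ₚ_
    ; _*_     = _*ₚ_
    ; -_      = List.map (-_)
    ; 0#      = []
    ; 1#      = 1# ∷ []
    }

-- R[X₀,…,Xₙ₋₁] = R[X₁,…,Xₙ₋₁][X₀]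

infix 9 _[X_]

_[X_] : ∀ {c ℓ} → RawRing c ℓ → ℕ → RawRing c ℓ
R [X zero ]  = R
R [X suc n ] = Univariate.polynomialRing (R [X n ])

module Multivariate {c ℓ : Level} (R : RawRing c ℓ) where

  Polynomial : ℕ → Set c
  Polynomial n = RawRing.Carrier (R [X n ])

  constant : ∀ n → RawRing.Carrier R → Polynomial n
  constant zero    a = a
  constant (suc n) a = constant n a ∷ []

  var : ∀ n → Fin n → Polynomial n
  var (suc n) zero    = RawRing.0# (R [X n ]) ∷ RawRing.1# (R [X n ]) ∷ []
  var (suc n) (suc i) = var n i ∷ []

  partial : ∀ n → Fin n → Polynomial n → Polynomial n
  partial (suc n) zero    = Univariate.derivative (R [X n ])
  partial (suc n) (suc i) = List.map (partial n i)

  AllCoefficients : (RawRing.Carrier R → Set c) → ∀ n → Polynomial n → Set c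
  AllCoefficients P zero    a = P a
  AllCoefficients P (suc n) f = All (AllCoefficients P n) f

  -- Evaluation at a point of Sⁿ, where φ : R → S makes S an R-algebra.
  evaluate : ∀ {s t} (S : RawRing s t) → (RawRing.Carrier R → RawRing.Carrier S) →
             ∀ n → Vector (RawRing.Carrier S) n → Polynomial n → RawRing.Carrier S
  evaluate S φ zero    v a = φ a
  evaluate S φ (suc n) v f =
    List.foldr (λ a r → evaluate S φ n (Vector.tail v) a + Vector.head v * r) 0# f
    where open RawRing S

open Matrices +-*-rawRing public using ()
  renaming (Matrix to Matrixℚ; _⊗_ to _⊗ℚ_; det to detℚ; adjugate to adjugateℚ)
open Multivariate +-*-rawRing public

ℚ[x,y,z] : RawRing 0ℓ 0ℓ
ℚ[x,y,z] = +-*-rawRing [X 3 ]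

⟨_∣_∣_⟩ : ∀ {ℓ} {S : Set ℓ} → S → S → S → Vector S 3
⟨ u ∣ v ∣ w ⟩ = u Vector.∷ v Vector.∷ w Vector.∷ Vector.[]

const : ℚ → Polynomial 3
const = constant 3

x y z : Polynomial 3
x = var 3 0F
y = var 3 1F
z = var 3 2F

linearForms : Matrixℚ 3 → Vector (Polynomial 3) 3
linearForms M i = sum (λ j → const (M i j) * ⟨ x ∣ y ∣ z ⟩ j)
  where
  open RawRing ℚ[x,y,z]
  open RawSemiringDefs rawSemiring using (sum)

substitute : Matrixℚ 3 → Polynomial 3 → Polynomial 3
substitute M = evaluate ℚ[x,y,z] const 3 (linearForms M)

quadraticForm : Matrixℚ 3 → Polynomial 3
quadraticForm M = sum (λ i → ⟨ x ∣ y ∣ z ⟩ i * linearForms M i)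
  where
  open RawRing ℚ[x,y,z]
  open RawSemiringDefs rawSemiring using (sum)

jacobian : Polynomial 3 → Polynomial 3 → Polynomial 3 → Polynomial 3
jacobian f g h = Matrices.det ℚ[x,y,z] {3} (λ i j → partial 3 j (⟨ f ∣ g ∣ h ⟩ i))

-- The gradient of xᵗMx is 2Mx, which makes the plain Jacobian of three quadratic
-- forms divisible by 8.  The normalisation used here divides by 8, so that the rows
-- of the determinant are Ax, Bx, (AB†A)x.  It cannot be dropped: 2 is not a unit
-- in ℤ[⅓], so a form divisible by 8 is not SL₃(ℤ[⅓])-equivalent to G, whose
-- x³-coefficient is 1.
cubicovariant : Matrixℚ 3 × Matrixℚ 3 → Polynomial 3
cubicovariant (A , B) =
  const (+ 1 / 8) * jacobian (quadraticForm A) (quadraticForm B)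
                                (quadraticForm (A ⊗ℚ (adjugateℚ B ⊗ℚ A)))
  where open RawRing ℚ[x,y,z]

_∈ℤ[⅓] : ℚ → Set
q ∈ℤ[⅓] = ∃₂ λ (m : ℤ) (k : ℕ) → q ≡ fromℤ m * (+ 1 / 3) ^ k
  where
  open RawRing +-*-rawRing using (_*_)
  open RawSemiringDefs +-*-rawSemiring using (_^_)

_∈SL₃[⅓ℤ] : Matrixℚ 3 → Set
M ∈SL₃[⅓ℤ] = (∀ i j → M i j ∈ℤ[⅓]) × detℚ M ≡ 1ℚ

-- H (x) = F (M x)
_∼[_]_ : Polynomial 3 → Matrixℚ 3 → Polynomial 3 → Set
F ∼[ M ] H = M ∈SL₃[⅓ℤ] × substitute M F ≈ H
  where open RawRing ℚ[x,y,z] using (_≈_)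

specialise : Polynomial 2 → ℤ → ℤ → ℚ
specialise f a b = evaluate +-*-rawRing id 2 (fromℤ a Vector.∷ fromℤ b Vector.∷ Vector.[]) f

-- An equivalence between families of forms indexed by (a , b) ∈ ℤ² is canonical when
-- its substitutions are the specialisations of a single matrix over ℤ[⅓][a,b].
CanonicallyEquivalent : (F H : ℤ → ℤ → Polynomial 3) → Set
CanonicallyEquivalent F H =
  Σ[ M ∈ Matrices.Matrix (+-*-rawRing [X 2 ]) 3 ]
    (∀ i j → AllCoefficients _∈ℤ[⅓] 2 (M i j)) ×
    (∀ a b → F a b ∼[ (λ i j → specialise (M i j) a b) ] H a b)

-- The parameters of the families below are integers, embedded in ℚ by fromℤ.

δ : ℚ → ℚ → ℚ
δ a b = b ^ 2 - fromℤ (+ 3) * a * b + fromℤ (+ 9) * a ^ 2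
  where
  open import Data.Rational.Base using (_+_; _-_; _*_)
  open RawSemiringDefs +-*-rawSemiring using (_^_)

A : ℚ → ℚ → Matrixℚ 3
A a b = ⟨ ⟨ 0ℚ ∣ 0ℚ  ∣ 1ℚ                    ⟩
        ∣ ⟨ 0ℚ ∣ - a ∣ 0ℚ                    ⟩
        ∣ ⟨ 1ℚ ∣ 0ℚ  ∣ - b + fromℤ (+ 3) * a ⟩ ⟩
  where open import Data.Rational.Base using (0ℚ; _+_; _*_; -_)

B : ℚ → ℚ → Matrixℚ 3
B a b = ⟨ ⟨ 0ℚ ∣ 1ℚ ∣ 0ℚ  ⟩
        ∣ ⟨ 1ℚ ∣ b  ∣ 0ℚ  ⟩
        ∣ ⟨ 0ℚ ∣ 0ℚ ∣ - a ⟩ ⟩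
  where open import Data.Rational.Base using (0ℚ; -_)

G : ℚ → ℚ → Polynomial 3
G a b =
  x ^ 3
  - const (δ a b ℚ.* (+ 1 / 3)) * (y ^ 2 + y * z + z ^ 2) * x
  - const (δ a b ℚ.* (+ 1 / 27)) *
    ( const (three ℚ.* a ℚ.- two ℚ.* b)           * y ^ 3
    + const (three ℚ.* (six ℚ.* a ℚ.- b))         * y ^ 2 * z
    + const (three ℚ.* (three ℚ.* a ℚ.+ b))       * y * z ^ 2
    - const (three ℚ.* a ℚ.- two ℚ.* b)           * z ^ 3 )
  where
  open RawRing ℚ[x,y,z] using (_+_; _*_; -_; rawSemiring)
  open RawSemiringDefs rawSemiring using (_^_)

  infixl 6 _-_
  _-_ : Polynomial 3 → Polynomial 3 → Polynomial 3
  f - g = f + (- g)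

  two three six : ℚ
  two   = fromℤ (+ 2)
  three = fromℤ (+ 3)
  six   = fromℤ (+ 6)

{-# OPTIONS --safe #-}

-- Completing the cube.  The x³-coefficient of C₃ is 1 and its x²-coefficient is
-- b y + (3a − b) z, so x ↦ x + (b/3) y + (a − b/3) z is the only unipotent shear in
-- x under which G can become C₃, and it has determinant 1.  That it does is an
-- identity in ℚ[a,b,x,y,z].  The Jacobian enters it through
-- ∂ⱼ(vᵗMv) = eⱼᵗMv + vᵗMeⱼ, which is free of derivatives.

module Submission where

open import Defs using (CanonicallyEquivalent; G; cubicovariant; A; B)
open import Data.Product.Base using (_,_)
open import Data.Rational.Literals using (fromℤ)

open import Algebra.Bundles using (CommutativeRing; RawRing)
import Algebra.Definitions.RawSemiring as RawSemiringDefs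
import Algebra.Properties.CommutativeMonoid.Sum as Sum
import Algebra.Properties.CommutativeSemigroup as CommutativeSemigroupProperties
import Algebra.Properties.Ring as RingProperties
import Algebra.Solver.Ring as RingSolver
open import Algebra.Solver.Ring.AlmostCommutativeRing
  using (fromCommutativeRing; _-Raw-AlmostCommutative⟶_; -raw-almostCommutative⟶)
open import Algebra.Structures using (IsCommutativeRing)
open import Data.Bool.Base using (true; false; if_then_else_)
open import Data.Fin.Base using (Fin; zero; suc; toℕ)
open import Data.Fin.Patterns using (0F; 1F; 2F; 3F; 4F)
open import Data.Fin.Properties using (_≟_)
open import Data.Integer.Base as ℤ using (ℤ; +_)
import Data.Integer.Properties as ℤ
open import Data.List.Base as List using (List; []; _∷_)
open import Data.List.Relation.Unary.All using ([]; _∷_)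
open import Data.Maybe.Base using (Maybe; nothing; just)
open import Data.Nat.Base as ℕ using (ℕ; zero; suc)
open import Data.Rational.Base as ℚ using (ℚ; 0ℚ; 1ℚ; _/_; +-*-rawRing)
import Data.Rational.Properties as ℚ
open import Data.Rational.Solver using (module +-*-Solver)
open import Data.Vec.Base using ([]; _∷_)
open import Data.Vec.Functional as Vector using (Vector)
open import Defs using
  ( module Matrices; module Univariate; module Multivariate; _[X_]; ⟨_∣_∣_⟩
  ; Matrixℚ; detℚ; ℚ[x,y,z]; linearForms; substitute; _∈ℤ[⅓])
open import Function.Base using (_∘_; id)
open import Level using (Level; _⊔_; 0ℓ)
open import Relation.Binary.Core using (REL)
open import Relation.Binary.PropositionalEquality as ≡ using (_≡_; cong)
import Relation.Binary.Reasoning.Setoid as SetoidReasoning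
open import Relation.Nullary.Decidable.Core using (does; yes; no)

-- The ring solver knows ring operations only, so it can check neither a derivative nor a
-- substitution as such. It is applied once, to formal expressions in five indeterminates, and no
-- nested coefficient list with symbolic `a` and `b` is ever expanded. The remaining work is to
-- recognise both sides of the claim as values of these expressions. The same formulas occur over
-- expressions, over `ℚ`, over `ℚ[a,b]` and over `ℚ[x,y,z]`; they are written once over an arbitrary
-- raw ring, and a relational induction compares the instances. Canonicity costs little: the entries
-- `b/3` and `a − b/3` of the shear are linear in `a` and `b` with coefficients in `ℤ[⅓]`, so a
-- single matrix serves all integer pairs.

private
  variable
    c ℓ c′ ℓ′ r s t : Level

-- Polynomial rings

module PolynomialRing (R : CommutativeRing c ℓ) where
  open CommutativeRing R
  open RingProperties ring using (-0#≈0#)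
  open CommutativeSemigroupProperties +-commutativeSemigroup using (interchange; x∙yz≈y∙xz)
  open SetoidReasoning setoid
  open Univariate rawRing public

  infixr 7 _·_
  _·_ : Carrier → List Carrier → List Carrier
  a · p = List.map (a *_) p

  infixr 6 _∷≈_
  _∷≈_ : ∀ {a b p q} → a ≈ b → p ≈ₚ q → (a ∷ p) ≈ₚ (b ∷ q)
  (a≈b ∷≈ p≈q) zero    = a≈b
  (a≈b ∷≈ p≈q) (suc k) = p≈q k

  0∷[]≈[] : (0# ∷ []) ≈ₚ []
  0∷[]≈[] zero    = refl
  0∷[]≈[] (suc k) = refl

  coefficient-map : ∀ {f : Carrier → Carrier} → f 0# ≈ 0# →
                    ∀ p k → coefficient (List.map f p) k ≈ f (coefficient p k)
  coefficient-map f0≈0 []      k       = sym f0≈0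
  coefficient-map f0≈0 (a ∷ p) zero    = refl
  coefficient-map f0≈0 (a ∷ p) (suc k) = coefficient-map f0≈0 p k

  coefficient-· : ∀ a p k → coefficient (a · p) k ≈ a * coefficient p k
  coefficient-· a = coefficient-map (zeroʳ a)

  coefficient-neg : ∀ p k → coefficient (List.map (-_) p) k ≈ - coefficient p k
  coefficient-neg = coefficient-map -0#≈0#

  coefficient-+ : ∀ p q k → coefficient (p +ₚ q) k ≈ coefficient p k + coefficient q k
  coefficient-+ []      q       k       = sym (+-identityˡ _)
  coefficient-+ (a ∷ p) []      k       = sym (+-identityʳ _)
  coefficient-+ (a ∷ p) (b ∷ q) zero    = refl
  coefficient-+ (a ∷ p) (b ∷ q) (suc k) = coefficient-+ p q k

  -- The lists are explicit arguments because `p ≈ₚ q` unfolds to a statement about coefficients,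
  -- from which unification cannot recover `p` and `q`.
  +ₚ-cong : ∀ p p′ q q′ → p ≈ₚ p′ → q ≈ₚ q′ → (p +ₚ q) ≈ₚ (p′ +ₚ q′)
  +ₚ-cong p p′ q q′ p≈ q≈ k = begin
    coefficient (p +ₚ q) k              ≈⟨ coefficient-+ p q k ⟩
    coefficient p k + coefficient q k   ≈⟨ +-cong (p≈ k) (q≈ k) ⟩
    coefficient p′ k + coefficient q′ k ≈⟨ coefficient-+ p′ q′ k ⟨
    coefficient (p′ +ₚ q′) k            ∎

  +ₚ-assoc : ∀ p q r → ((p +ₚ q) +ₚ r) ≈ₚ (p +ₚ (q +ₚ r))
  +ₚ-assoc p q r k = begin
    coefficient ((p +ₚ q) +ₚ r) k                             ≈⟨ coefficient-+ (p +ₚ q) r k ⟩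
    coefficient (p +ₚ q) k + coefficient r k                  ≈⟨ +-congʳ (coefficient-+ p q k) ⟩
    coefficient p k + coefficient q k + coefficient r k       ≈⟨ +-assoc _ _ _ ⟩
    coefficient p k + (coefficient q k + coefficient r k)     ≈⟨ +-congˡ (coefficient-+ q r k) ⟨
    coefficient p k + coefficient (q +ₚ r) k                  ≈⟨ coefficient-+ p (q +ₚ r) k ⟨
    coefficient (p +ₚ (q +ₚ r)) k                             ∎

  +ₚ-comm : ∀ p q → (p +ₚ q) ≈ₚ (q +ₚ p)
  +ₚ-comm p q k = begin
    coefficient (p +ₚ q) k            ≈⟨ coefficient-+ p q k ⟩
    coefficient p k + coefficient q k ≈⟨ +-comm _ _ ⟩
    coefficient q k + coefficient p k ≈⟨ coefficient-+ q p k ⟨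
    coefficient (q +ₚ p) k            ∎

  +ₚ-identityʳ : ∀ p → (p +ₚ []) ≈ₚ p
  +ₚ-identityʳ p k = trans (coefficient-+ p [] k) (+-identityʳ _)

  -ₚ-cong : ∀ p q → p ≈ₚ q → List.map (-_) p ≈ₚ List.map (-_) q
  -ₚ-cong p q p≈q k =
    trans (coefficient-neg p k) (trans (-‿cong (p≈q k)) (sym (coefficient-neg q k)))

  -ₚ-inverseʳ : ∀ p → (p +ₚ List.map (-_) p) ≈ₚ []
  -ₚ-inverseʳ p k = begin
    coefficient (p +ₚ List.map (-_) p) k              ≈⟨ coefficient-+ p _ k ⟩
    coefficient p k + coefficient (List.map (-_) p) k ≈⟨ +-congˡ (coefficient-neg p k) ⟩
    coefficient p k + - coefficient p k               ≈⟨ -‿inverseʳ _ ⟩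
    0#                                                ∎

  coefficient-∷* : ∀ a p q k →
    coefficient ((a ∷ p) *ₚ q) k ≈ a * coefficient q k + coefficient (0# ∷ p *ₚ q) k
  coefficient-∷* a p q k =
    trans (coefficient-+ (a · q) (0# ∷ p *ₚ q) k) (+-congʳ (coefficient-· a q k))

  *ₚ-congˡ : ∀ p q q′ → q ≈ₚ q′ → (p *ₚ q) ≈ₚ (p *ₚ q′)
  *ₚ-congˡ []      q q′ q≈ k = refl
  *ₚ-congˡ (a ∷ p) q q′ q≈ k = begin
    coefficient ((a ∷ p) *ₚ q) k                          ≈⟨ coefficient-∷* a p q k ⟩
    a * coefficient q k + coefficient (0# ∷ p *ₚ q) k     ≈⟨ +-cong (*-congˡ (q≈ k)) ((refl ∷≈ *ₚ-congˡ p q q′ q≈) k) ⟩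
    a * coefficient q′ k + coefficient (0# ∷ p *ₚ q′) k   ≈⟨ coefficient-∷* a p q′ k ⟨
    coefficient ((a ∷ p) *ₚ q′) k                         ∎

  *ₚ-zeroʳ : ∀ p → (p *ₚ []) ≈ₚ []
  *ₚ-zeroʳ []      k       = refl
  *ₚ-zeroʳ (a ∷ p) zero    = refl
  *ₚ-zeroʳ (a ∷ p) (suc k) = *ₚ-zeroʳ p k

  -- Multiplication recurses on its left factor; this is the matching expansion along the right one.
  -- Comparing the two gives commutativity, which in turn yields right congruence and right
  -- distributivity from the left versions.
  coefficient-*∷ : ∀ p b q k →
    coefficient (p *ₚ (b ∷ q)) k ≈ b * coefficient p k + coefficient (0# ∷ p *ₚ q) k
  coefficient-*∷ []      b q k       = begin
    0#                               ≈⟨ zeroʳ b ⟨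
    b * 0#                           ≈⟨ +-identityʳ _ ⟨
    b * 0# + 0#                      ≈⟨ +-congˡ (0∷[]≈[] k) ⟨
    b * 0# + coefficient (0# ∷ []) k ∎
  coefficient-*∷ (a ∷ p) b q zero    = +-congʳ (*-comm a b)
  coefficient-*∷ (a ∷ p) b q (suc k) = begin
    coefficient (a · q +ₚ p *ₚ (b ∷ q)) k
      ≈⟨ coefficient-+ (a · q) (p *ₚ (b ∷ q)) k ⟩
    coefficient (a · q) k + coefficient (p *ₚ (b ∷ q)) k
      ≈⟨ +-congˡ (coefficient-*∷ p b q k) ⟩
    coefficient (a · q) k + (b * coefficient p k + coefficient (0# ∷ p *ₚ q) k)
      ≈⟨ x∙yz≈y∙xz _ _ _ ⟩
    b * coefficient p k + (coefficient (a · q) k + coefficient (0# ∷ p *ₚ q) k)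
      ≈⟨ +-congˡ (coefficient-+ (a · q) (0# ∷ p *ₚ q) k) ⟨
    b * coefficient p k + coefficient ((a ∷ p) *ₚ q) k
      ∎

  *ₚ-comm : ∀ p q → (p *ₚ q) ≈ₚ (q *ₚ p)
  *ₚ-comm []      q k = sym (*ₚ-zeroʳ q k)
  *ₚ-comm (a ∷ p) q k = begin
    coefficient ((a ∷ p) *ₚ q) k                      ≈⟨ coefficient-∷* a p q k ⟩
    a * coefficient q k + coefficient (0# ∷ p *ₚ q) k ≈⟨ +-congˡ ((refl ∷≈ *ₚ-comm p q) k) ⟩
    a * coefficient q k + coefficient (0# ∷ q *ₚ p) k ≈⟨ coefficient-*∷ q a p k ⟨
    coefficient (q *ₚ (a ∷ p)) k                      ∎

  *ₚ-congʳ : ∀ p p′ q → p ≈ₚ p′ → (p *ₚ q) ≈ₚ (p′ *ₚ q)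
  *ₚ-congʳ p p′ q p≈ k =
    trans (*ₚ-comm p q k) (trans (*ₚ-congˡ q p p′ p≈ k) (*ₚ-comm q p′ k))

  *ₚ-distribˡ : ∀ p q r → (p *ₚ (q +ₚ r)) ≈ₚ (p *ₚ q +ₚ p *ₚ r)
  *ₚ-distribˡ []      q r k = refl
  *ₚ-distribˡ (a ∷ p) q r k = begin
    coefficient ((a ∷ p) *ₚ (q +ₚ r)) k
      ≈⟨ coefficient-∷* a p (q +ₚ r) k ⟩
    a * coefficient (q +ₚ r) k + coefficient (0# ∷ p *ₚ (q +ₚ r)) k
      ≈⟨ +-cong (trans (*-congˡ (coefficient-+ q r k)) (distribˡ _ _ _)) (shift k) ⟩
    (a * coefficient q k + a * coefficient r k) +
    (coefficient (0# ∷ p *ₚ q) k + coefficient (0# ∷ p *ₚ r) k)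
      ≈⟨ interchange _ _ _ _ ⟩
    (a * coefficient q k + coefficient (0# ∷ p *ₚ q) k) +
    (a * coefficient r k + coefficient (0# ∷ p *ₚ r) k)
      ≈⟨ +-cong (coefficient-∷* a p q k) (coefficient-∷* a p r k) ⟨
    coefficient ((a ∷ p) *ₚ q) k + coefficient ((a ∷ p) *ₚ r) k
      ≈⟨ coefficient-+ ((a ∷ p) *ₚ q) ((a ∷ p) *ₚ r) k ⟨
    coefficient ((a ∷ p) *ₚ q +ₚ (a ∷ p) *ₚ r) k
      ∎
    where
    shift : ∀ k → coefficient (0# ∷ p *ₚ (q +ₚ r)) k ≈
                  coefficient (0# ∷ p *ₚ q) k + coefficient (0# ∷ p *ₚ r) k
    shift zero    = sym (+-identityʳ 0#)
    shift (suc k) = trans (*ₚ-distribˡ p q r k) (coefficient-+ (p *ₚ q) (p *ₚ r) k)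

  *ₚ-distribʳ : ∀ r p q → ((p +ₚ q) *ₚ r) ≈ₚ (p *ₚ r +ₚ q *ₚ r)
  *ₚ-distribʳ r p q k = begin
    coefficient ((p +ₚ q) *ₚ r) k     ≈⟨ *ₚ-comm (p +ₚ q) r k ⟩
    coefficient (r *ₚ (p +ₚ q)) k     ≈⟨ *ₚ-distribˡ r p q k ⟩
    coefficient (r *ₚ p +ₚ r *ₚ q) k  ≈⟨ +ₚ-cong (r *ₚ p) (p *ₚ r) (r *ₚ q) (q *ₚ r) (*ₚ-comm r p) (*ₚ-comm r q) k ⟩
    coefficient (p *ₚ r +ₚ q *ₚ r) k  ∎

  -- Associativity splits along `(a ∷ p) *ₚ q = a · q +ₚ (0# ∷ p *ₚ q)`: this handles the scalar
  -- summand, and `0∷-*ₚ` the summand multiplied by the indeterminate.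
  ·-*ₚ : ∀ a p q k → coefficient ((a · p) *ₚ q) k ≈ a * coefficient (p *ₚ q) k
  ·-*ₚ a []      q k = sym (zeroʳ a)
  ·-*ₚ a (b ∷ p) q k = begin
    coefficient ((a · (b ∷ p)) *ₚ q) k
      ≈⟨ coefficient-∷* (a * b) (a · p) q k ⟩
    a * b * coefficient q k + coefficient (0# ∷ (a · p) *ₚ q) k
      ≈⟨ +-cong (*-assoc _ _ _) (shift k) ⟩
    a * (b * coefficient q k) + a * coefficient (0# ∷ p *ₚ q) k
      ≈⟨ distribˡ _ _ _ ⟨
    a * (b * coefficient q k + coefficient (0# ∷ p *ₚ q) k)
      ≈⟨ *-congˡ (coefficient-∷* b p q k) ⟨
    a * coefficient ((b ∷ p) *ₚ q) k
      ∎
    where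
    shift : ∀ k → coefficient (0# ∷ (a · p) *ₚ q) k ≈ a * coefficient (0# ∷ p *ₚ q) k
    shift zero    = sym (zeroʳ a)
    shift (suc k) = ·-*ₚ a p q k

  0∷-*ₚ : ∀ p q → ((0# ∷ p) *ₚ q) ≈ₚ (0# ∷ p *ₚ q)
  0∷-*ₚ p q k = trans (coefficient-∷* 0# p q k) (trans (+-congʳ (zeroˡ _)) (+-identityˡ _))

  *ₚ-assoc : ∀ p q r → ((p *ₚ q) *ₚ r) ≈ₚ (p *ₚ (q *ₚ r))
  *ₚ-assoc []      q r k = refl
  *ₚ-assoc (a ∷ p) q r k = begin
    coefficient ((a · q +ₚ (0# ∷ p *ₚ q)) *ₚ r) k
      ≈⟨ *ₚ-distribʳ r (a · q) (0# ∷ p *ₚ q) k ⟩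
    coefficient ((a · q) *ₚ r +ₚ (0# ∷ p *ₚ q) *ₚ r) k
      ≈⟨ coefficient-+ ((a · q) *ₚ r) ((0# ∷ p *ₚ q) *ₚ r) k ⟩
    coefficient ((a · q) *ₚ r) k + coefficient ((0# ∷ p *ₚ q) *ₚ r) k
      ≈⟨ +-cong (·-*ₚ a q r k) (0∷-*ₚ (p *ₚ q) r k) ⟩
    a * coefficient (q *ₚ r) k + coefficient (0# ∷ (p *ₚ q) *ₚ r) k
      ≈⟨ +-congˡ ((refl ∷≈ *ₚ-assoc p q r) k) ⟩
    a * coefficient (q *ₚ r) k + coefficient (0# ∷ p *ₚ (q *ₚ r)) k
      ≈⟨ coefficient-∷* a p (q *ₚ r) k ⟨
    coefficient ((a ∷ p) *ₚ (q *ₚ r)) k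
      ∎

  *ₚ-identityˡ : ∀ p → ((1# ∷ []) *ₚ p) ≈ₚ p
  *ₚ-identityˡ p k = begin
    coefficient ((1# ∷ []) *ₚ p) k                ≈⟨ coefficient-∷* 1# [] p k ⟩
    1# * coefficient p k + coefficient (0# ∷ []) k ≈⟨ +-cong (*-identityˡ _) (0∷[]≈[] k) ⟩
    coefficient p k + 0#                           ≈⟨ +-identityʳ _ ⟩
    coefficient p k                                ∎

  polynomialCommutativeRing : CommutativeRing c ℓ
  polynomialCommutativeRing = record
    { RawRing polynomialRing
    ; isCommutativeRing = record
      { isRing = record
        { +-isAbelianGroup = record
          { isGroup = record
            { isMonoid = record
              { isSemigroup = record
                { isMagma = record
                  { isEquivalence = record
                    { refl  = λ k → refl
                    ; sym   = λ p≈q k → sym (p≈q k)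
                    ; trans = λ p≈q q≈r k → trans (p≈q k) (q≈r k)
                    }
                  ; ∙-cong = λ {p} {p′} {q} {q′} → +ₚ-cong p p′ q q′
                  }
                ; assoc = +ₚ-assoc
                }
              ; identity = (λ p k → refl) , +ₚ-identityʳ
              }
            ; inverse = (λ p k → trans (+ₚ-comm (List.map (-_) p) p k) (-ₚ-inverseʳ p k))
                      , -ₚ-inverseʳ
            ; ⁻¹-cong = λ {p} {q} → -ₚ-cong p q
            }
          ; comm = +ₚ-comm
          }
        ; *-cong = λ {p} {p′} {q} {q′} p≈ q≈ k →
            trans (*ₚ-congʳ p p′ q p≈ k) (*ₚ-congˡ p′ q q′ q≈ k)
        ; *-assoc = *ₚ-assoc
        ; *-identity = *ₚ-identityˡ
                     , λ p k → trans (*ₚ-comm p (1# ∷ []) k) (*ₚ-identityˡ p k)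
        ; distrib = *ₚ-distribˡ , *ₚ-distribʳ
        }
      ; *-comm = *ₚ-comm
      }
    }

-- Axioms are kept apart from operations so that `bundle` yields a ring whose raw ring is
-- definitionally the given one, even when the axioms are abstract.
IsCommutative : RawRing c ℓ → Set (c ⊔ ℓ)
IsCommutative K = IsCommutativeRing _≈_ _+_ _*_ -_ 0# 1#
  where open RawRing K

bundle : (K : RawRing c ℓ) → IsCommutative K → CommutativeRing c ℓ
bundle K isCommutative = record { RawRing K; isCommutativeRing = isCommutative }

-- Abstract, as comparing the towers of ring axioms by unfolding is prohibitively slow.
abstract
  [X]-isCommutative : (K : RawRing c ℓ) → IsCommutative K → ∀ n → IsCommutative (K [X n ])
  [X]-isCommutative K K-comm zero    = K-comm
  [X]-isCommutative K K-comm (suc n) =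
    CommutativeRing.isCommutativeRing
      (PolynomialRing.polynomialCommutativeRing
        (bundle (K [X n ]) ([X]-isCommutative K K-comm n)))

polynomials : (K : RawRing c ℓ) → IsCommutative K → ℕ → CommutativeRing c ℓ
polynomials K K-comm n = bundle (K [X n ]) ([X]-isCommutative K K-comm n)

-- Homomorphisms from polynomial rings

infix 4 _⟶_

-- Such a map preserves the operations and its source carries no laws, so formal expressions under
-- syntactic equality qualify as a source.
_⟶_ : RawRing c ℓ → CommutativeRing s t → Set _
K ⟶ S = K -Raw-AlmostCommutative⟶ fromCommutativeRing S

open _-Raw-AlmostCommutative⟶_

module _ {K : RawRing c ℓ} (S : CommutativeRing s t) (φ : K ⟶ S) where
  open CommutativeRing S
  open RingProperties ring using (-0#≈0#; -‿+-comm; -‿distribʳ-*)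
  open CommutativeSemigroupProperties +-commutativeSemigroup using (interchange)
  open CommutativeSemigroupProperties *-commutativeSemigroup using (x∙yz≈y∙xz)
  open SetoidReasoning setoid
  private
    module K = RawRing K
    open Univariate K using (_+ₚ_; _*ₚ_)

  horner-⟶ : Carrier → Univariate.polynomialRing K ⟶ S
  horner-⟶ v = record
    { ⟦_⟧    = ev
    ; +-homo = ev-+
    ; *-homo = ev-*
    ; -‿homo = ev-neg
    ; 0-homo = refl
    ; 1-homo = begin
        ⟦ φ ⟧ K.1# + v * 0# ≈⟨ +-cong (1-homo φ) (zeroʳ v) ⟩
        1# + 0#             ≈⟨ +-identityʳ 1# ⟩
        1#                  ∎
    }
    where
    ev : List K.Carrier → Carrier
    ev = List.foldr (λ a r → ⟦ φ ⟧ a + v * r) 0#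

    ev-+ : ∀ p q → ev (p +ₚ q) ≈ ev p + ev q
    ev-+ []      q       = sym (+-identityˡ _)
    ev-+ (a ∷ p) []      = sym (+-identityʳ _)
    ev-+ (a ∷ p) (b ∷ q) = begin
      ⟦ φ ⟧ (a K.+ b) + v * ev (p +ₚ q)               ≈⟨ +-cong (+-homo φ a b) (*-congˡ (ev-+ p q)) ⟩
      (⟦ φ ⟧ a + ⟦ φ ⟧ b) + v * (ev p + ev q)         ≈⟨ +-congˡ (distribˡ _ _ _) ⟩
      (⟦ φ ⟧ a + ⟦ φ ⟧ b) + (v * ev p + v * ev q)     ≈⟨ interchange _ _ _ _ ⟩
      (⟦ φ ⟧ a + v * ev p) + (⟦ φ ⟧ b + v * ev q)     ∎

    ev-neg : ∀ p → ev (List.map K.-_ p) ≈ - ev p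
    ev-neg []      = sym -0#≈0#
    ev-neg (a ∷ p) = begin
      ⟦ φ ⟧ (K.- a) + v * ev (List.map K.-_ p) ≈⟨ +-cong (-‿homo φ a) (*-congˡ (ev-neg p)) ⟩
      - ⟦ φ ⟧ a + v * - ev p                   ≈⟨ +-congˡ (-‿distribʳ-* v (ev p)) ⟨
      - ⟦ φ ⟧ a + - (v * ev p)                 ≈⟨ -‿+-comm _ _ ⟩
      - (⟦ φ ⟧ a + v * ev p)                   ∎

    ev-scale : ∀ a p → ev (List.map (a K.*_) p) ≈ ⟦ φ ⟧ a * ev p
    ev-scale a []      = sym (zeroʳ _)
    ev-scale a (b ∷ p) = begin
      ⟦ φ ⟧ (a K.* b) + v * ev (List.map (a K.*_) p) ≈⟨ +-cong (*-homo φ a b) (*-congˡ (ev-scale a p)) ⟩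
      ⟦ φ ⟧ a * ⟦ φ ⟧ b + v * (⟦ φ ⟧ a * ev p)       ≈⟨ +-congˡ (x∙yz≈y∙xz _ _ _) ⟩
      ⟦ φ ⟧ a * ⟦ φ ⟧ b + ⟦ φ ⟧ a * (v * ev p)       ≈⟨ distribˡ _ _ _ ⟨
      ⟦ φ ⟧ a * (⟦ φ ⟧ b + v * ev p)                 ∎

    ev-* : ∀ p q → ev (p *ₚ q) ≈ ev p * ev q
    ev-* []      q = sym (zeroˡ _)
    ev-* (a ∷ p) q = begin
      ev (List.map (a K.*_) q +ₚ (K.0# ∷ p *ₚ q))                   ≈⟨ ev-+ (List.map (a K.*_) q) _ ⟩
      ev (List.map (a K.*_) q) + (⟦ φ ⟧ K.0# + v * ev (p *ₚ q))     ≈⟨ +-cong (ev-scale a q) (+-cong (0-homo φ) (*-congˡ (ev-* p q))) ⟩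
      ⟦ φ ⟧ a * ev q + (0# + v * (ev p * ev q))                     ≈⟨ +-congˡ (+-identityˡ _) ⟩
      ⟦ φ ⟧ a * ev q + v * (ev p * ev q)                            ≈⟨ +-congˡ (*-assoc _ _ _) ⟨
      ⟦ φ ⟧ a * ev q + v * ev p * ev q                              ≈⟨ distribʳ _ _ _ ⟨
      (⟦ φ ⟧ a + v * ev p) * ev q                                   ∎

module _ (K : RawRing c ℓ) (S : CommutativeRing s t) (φ : K ⟶ S) where
  open CommutativeRing S using (Carrier)

  -- The fold in `horner-⟶` is the one that defines `evaluate`, so for a concrete number of
  -- variables the underlying map is evaluation definitionally.
  evaluate-⟶ : ∀ n → Vector Carrier n → (K [X n ]) ⟶ S
  evaluate-⟶ zero    v = φ
  evaluate-⟶ (suc n) v = horner-⟶ S (evaluate-⟶ n (Vector.tail v)) (Vector.head v)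

module _ {K : RawRing c ℓ} (S : CommutativeRing s t) (φ : K ⟶ S) where
  open CommutativeRing S
  open SetoidReasoning setoid
  open Multivariate K

  evaluate-constant : ∀ n v a → ⟦ evaluate-⟶ K S φ n v ⟧ (constant n a) ≈ ⟦ φ ⟧ a
  evaluate-constant zero    v a = refl
  evaluate-constant (suc n) v a =
    trans (+-cong (evaluate-constant n (Vector.tail v) a) (zeroʳ _)) (+-identityʳ _)

  evaluate-var : ∀ n v i → ⟦ evaluate-⟶ K S φ n v ⟧ (var n i) ≈ v i
  evaluate-var (suc n) v zero    = begin
    ⟦ ev ⟧ 0ₙ + h * (⟦ ev ⟧ 1ₙ + h * 0#) ≈⟨ +-cong (0-homo ev) (*-congˡ (+-cong (1-homo ev) (zeroʳ h))) ⟩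
    0# + h * (1# + 0#)                   ≈⟨ +-identityˡ _ ⟩
    h * (1# + 0#)                        ≈⟨ *-congˡ (+-identityʳ 1#) ⟩
    h * 1#                               ≈⟨ *-identityʳ h ⟩
    h                                    ∎
    where
    h  = Vector.head v
    ev = evaluate-⟶ K S φ n (Vector.tail v)
    open RawRing (K [X n ]) using () renaming (0# to 0ₙ; 1# to 1ₙ)
  evaluate-var (suc n) v (suc i) =
    trans (+-cong (evaluate-var n (Vector.tail v) i) (zeroʳ _)) (+-identityʳ _)

module _ (K : RawRing c ℓ) (K-comm : IsCommutative K) where
  open Multivariate K

  private
    module K = RawRing K
    module Kₙ n = CommutativeRing (polynomials K K-comm n)

  constant-⟶ : ∀ n → K ⟶ polynomials K K-comm n
  constant-⟶ n = record
    { ⟦_⟧    = constant n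
    ; +-homo = constant-+ n
    ; *-homo = constant-* n
    ; -‿homo = constant-neg n
    ; 0-homo = constant-0 n
    ; 1-homo = constant-1 n
    }
    where
    constant-+ : ∀ n a b → Kₙ._≈_ n (constant n (a K.+ b)) (Kₙ._+_ n (constant n a) (constant n b))
    constant-+ zero    a b         = Kₙ.refl 0
    constant-+ (suc n) a b zero    = constant-+ n a b
    constant-+ (suc n) a b (suc k) = Kₙ.refl n

    constant-* : ∀ n a b → Kₙ._≈_ n (constant n (a K.* b)) (Kₙ._*_ n (constant n a) (constant n b))
    constant-* zero    a b         = Kₙ.refl 0
    constant-* (suc n) a b zero    =
      Kₙ.trans n (constant-* n a b) (Kₙ.sym n (Kₙ.+-identityʳ n _))
    constant-* (suc n) a b (suc k) = Kₙ.refl n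

    constant-neg : ∀ n a → Kₙ._≈_ n (constant n (K.- a)) (Kₙ.-_ n (constant n a))
    constant-neg zero    a         = Kₙ.refl 0
    constant-neg (suc n) a zero    = constant-neg n a
    constant-neg (suc n) a (suc k) = Kₙ.refl n

    constant-0 : ∀ n → Kₙ._≈_ n (constant n K.0#) (Kₙ.0# n)
    constant-0 zero            = Kₙ.refl 0
    constant-0 (suc n) zero    = constant-0 n
    constant-0 (suc n) (suc k) = Kₙ.refl n

    constant-1 : ∀ n → Kₙ._≈_ n (constant n K.1#) (Kₙ.1# n)
    constant-1 zero            = Kₙ.refl 0
    constant-1 (suc n) zero    = constant-1 n
    constant-1 (suc n) (suc k) = Kₙ.refl n

-- Derivations

module Bilinear (K : RawRing c ℓ) where
  open RawRing K
  open RawSemiringDefs rawSemiring using (sum)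
  open Matrices K using (Matrix)

  bilinear : ∀ {n} → Matrix n → (u v : Vector Carrier n) → Carrier
  bilinear M u v = sum (λ i → u i * sum (λ j → M i j * v j))

  unit : ∀ {n} → Fin n → Vector Carrier n
  unit i j = if does (i ≟ j) then 1# else 0#

-- `D` is not assumed to respect `≈`, so `D-0` does not follow from `D-+` and is a field.
record IsDerivation (K : RawRing c ℓ)
                    (D : RawRing.Carrier K → RawRing.Carrier K) : Set (c ⊔ ℓ) where
  open RawRing K
  field
    D-0 : D 0# ≈ 0#
    D-+ : ∀ f g → D (f + g) ≈ D f + D g
    D-* : ∀ f g → D (f * g) ≈ D f * g + f * D g

module _ (S : CommutativeRing c ℓ) where
  open CommutativeRing S
  open PolynomialRing S
  open CommutativeSemigroupProperties +-commutativeSemigroup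
    using (interchange; x∙yz≈y∙xz)
  open SetoidReasoning setoid

  derivative-+ : ∀ p q → derivative (p +ₚ q) ≈ₚ (derivative p +ₚ derivative q)
  derivative-+ []      q       k = refl
  derivative-+ (a ∷ p) []      k = sym (+ₚ-identityʳ (derivative (a ∷ p)) k)
  derivative-+ (a ∷ p) (b ∷ q) k = begin
    coefficient ((p +ₚ q) +ₚ (0# ∷ derivative (p +ₚ q))) k
      ≈⟨ coefficient-+ (p +ₚ q) _ k ⟩
    coefficient (p +ₚ q) k + coefficient (0# ∷ derivative (p +ₚ q)) k
      ≈⟨ +-cong (coefficient-+ p q k) (shift k) ⟩
    (coefficient p k + coefficient q k) +
    (coefficient (0# ∷ derivative p) k + coefficient (0# ∷ derivative q) k)
      ≈⟨ interchange _ _ _ _ ⟩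
    (coefficient p k + coefficient (0# ∷ derivative p) k) +
    (coefficient q k + coefficient (0# ∷ derivative q) k)
      ≈⟨ +-cong (coefficient-+ p _ k) (coefficient-+ q _ k) ⟨
    coefficient (derivative (a ∷ p)) k + coefficient (derivative (b ∷ q)) k
      ≈⟨ coefficient-+ (derivative (a ∷ p)) (derivative (b ∷ q)) k ⟨
    coefficient (derivative (a ∷ p) +ₚ derivative (b ∷ q)) k
      ∎
    where
    shift : ∀ k → coefficient (0# ∷ derivative (p +ₚ q)) k ≈
                  coefficient (0# ∷ derivative p) k + coefficient (0# ∷ derivative q) k
    shift zero    = sym (+-identityʳ 0#)
    shift (suc k) = trans (derivative-+ p q k) (coefficient-+ (derivative p) (derivative q) k)

  derivative-· : ∀ a p k → coefficient (derivative (a · p)) k ≈ a * coefficient (derivative p) k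
  derivative-· a []      k = sym (zeroʳ a)
  derivative-· a (b ∷ p) k = begin
    coefficient (a · p +ₚ (0# ∷ derivative (a · p))) k
      ≈⟨ coefficient-+ (a · p) _ k ⟩
    coefficient (a · p) k + coefficient (0# ∷ derivative (a · p)) k
      ≈⟨ +-cong (coefficient-· a p k) (shift k) ⟩
    a * coefficient p k + a * coefficient (0# ∷ derivative p) k
      ≈⟨ distribˡ _ _ _ ⟨
    a * (coefficient p k + coefficient (0# ∷ derivative p) k)
      ≈⟨ *-congˡ (coefficient-+ p _ k) ⟨
    a * coefficient (derivative (b ∷ p)) k
      ∎
    where
    shift : ∀ k → coefficient (0# ∷ derivative (a · p)) k ≈ a * coefficient (0# ∷ derivative p) k
    shift zero    = sym (zeroʳ a)
    shift (suc k) = derivative-· a p k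

  -- Since `(a + X p)′ = p + X p′`, the derivative of `(a + X p) q` is `a q′ + p q + X (p q)′`.
  -- Induction turns the last term into `X p′ q + X p q′`, and regrouping gives
  -- `(p + X p′) q + (a + X p) q′`.
  derivative-* : ∀ p q → derivative (p *ₚ q) ≈ₚ (derivative p *ₚ q +ₚ p *ₚ derivative q)
  derivative-* []      q k = refl
  derivative-* (a ∷ p) q k = begin
    coefficient (derivative (a · q +ₚ (0# ∷ p *ₚ q))) k
      ≈⟨ derivative-+ (a · q) (0# ∷ p *ₚ q) k ⟩
    coefficient (derivative (a · q) +ₚ derivative (0# ∷ p *ₚ q)) k
      ≈⟨ coefficient-+ (derivative (a · q)) _ k ⟩
    coefficient (derivative (a · q)) k + coefficient (p *ₚ q +ₚ (0# ∷ derivative (p *ₚ q))) k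
      ≈⟨ +-cong (derivative-· a q k) (coefficient-+ (p *ₚ q) _ k) ⟩
    a * coefficient q′ k + (coefficient (p *ₚ q) k + coefficient (0# ∷ derivative (p *ₚ q)) k)
      ≈⟨ +-congˡ (+-congˡ (shift k)) ⟩
    a * coefficient q′ k +
    (coefficient (p *ₚ q) k + (coefficient (0# ∷ p′ *ₚ q) k + coefficient (0# ∷ p *ₚ q′) k))
      ≈⟨ +-congˡ (+-assoc _ _ _) ⟨
    a * coefficient q′ k +
    (coefficient (p *ₚ q) k + coefficient (0# ∷ p′ *ₚ q) k + coefficient (0# ∷ p *ₚ q′) k)
      ≈⟨ x∙yz≈y∙xz _ _ _ ⟩
    coefficient (p *ₚ q) k + coefficient (0# ∷ p′ *ₚ q) k +
    (a * coefficient q′ k + coefficient (0# ∷ p *ₚ q′) k)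
      ≈⟨ +-cong (+-congˡ (0∷-*ₚ p′ q k)) (coefficient-∷* a p q′ k) ⟨
    coefficient (p *ₚ q) k + coefficient ((0# ∷ p′) *ₚ q) k + coefficient ((a ∷ p) *ₚ q′) k
      ≈⟨ +-congʳ (coefficient-+ (p *ₚ q) _ k) ⟨
    coefficient (p *ₚ q +ₚ (0# ∷ p′) *ₚ q) k + coefficient ((a ∷ p) *ₚ q′) k
      ≈⟨ +-congʳ (*ₚ-distribʳ q p (0# ∷ p′) k) ⟨
    coefficient (derivative (a ∷ p) *ₚ q) k + coefficient ((a ∷ p) *ₚ q′) k
      ≈⟨ coefficient-+ (derivative (a ∷ p) *ₚ q) _ k ⟨
    coefficient (derivative (a ∷ p) *ₚ q +ₚ (a ∷ p) *ₚ q′) k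
      ∎
    where
    p′ = derivative p
    q′ = derivative q

    shift : ∀ k → coefficient (0# ∷ derivative (p *ₚ q)) k ≈
                  coefficient (0# ∷ p′ *ₚ q) k + coefficient (0# ∷ p *ₚ q′) k
    shift zero    = sym (+-identityʳ 0#)
    shift (suc k) = trans (derivative-* p q k) (coefficient-+ (p′ *ₚ q) (p *ₚ q′) k)

  derivative-isDerivation : IsDerivation polynomialRing derivative
  derivative-isDerivation = record
    { D-0 = λ _ → refl
    ; D-+ = derivative-+
    ; D-* = derivative-*
    }

  module _ {D : Carrier → Carrier} (D-isDerivation : IsDerivation rawRing D) where
    open IsDerivation D-isDerivation

    map-+ : ∀ p q → List.map D (p +ₚ q) ≈ₚ (List.map D p +ₚ List.map D q)
    map-+ []      q       k       = refl
    map-+ (a ∷ p) []      k       = refl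
    map-+ (a ∷ p) (b ∷ q) zero    = D-+ a b
    map-+ (a ∷ p) (b ∷ q) (suc k) = map-+ p q k

    -- `List.map D` treats the outer indeterminate as a constant, so the product rule for `D` on
    -- coefficients is all that is required.
    map-* : ∀ p q → List.map D (p *ₚ q) ≈ₚ (List.map D p *ₚ q +ₚ p *ₚ List.map D q)
    map-* []      q k = refl
    map-* (a ∷ p) q k = begin
      coefficient (List.map D (a · q +ₚ (0# ∷ p *ₚ q))) k
        ≈⟨ map-+ (a · q) (0# ∷ p *ₚ q) k ⟩
      coefficient (List.map D (a · q) +ₚ (D 0# ∷ List.map D (p *ₚ q))) k
        ≈⟨ coefficient-+ (List.map D (a · q)) _ k ⟩
      coefficient (List.map D (a · q)) k + coefficient (D 0# ∷ List.map D (p *ₚ q)) k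
        ≈⟨ +-cong (scale q k) (shift k) ⟩
      (D a * coefficient q k + a * coefficient (List.map D q) k) +
      (coefficient (0# ∷ List.map D p *ₚ q) k + coefficient (0# ∷ p *ₚ List.map D q) k)
        ≈⟨ interchange _ _ _ _ ⟩
      (D a * coefficient q k + coefficient (0# ∷ List.map D p *ₚ q) k) +
      (a * coefficient (List.map D q) k + coefficient (0# ∷ p *ₚ List.map D q) k)
        ≈⟨ +-cong (coefficient-∷* (D a) (List.map D p) q k) (coefficient-∷* a p (List.map D q) k) ⟨
      coefficient (List.map D (a ∷ p) *ₚ q) k + coefficient ((a ∷ p) *ₚ List.map D q) k
        ≈⟨ coefficient-+ (List.map D (a ∷ p) *ₚ q) _ k ⟨
      coefficient (List.map D (a ∷ p) *ₚ q +ₚ (a ∷ p) *ₚ List.map D q) k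
        ∎
      where
      scale : ∀ q k → coefficient (List.map D (a · q)) k ≈
                      D a * coefficient q k + a * coefficient (List.map D q) k
      scale []      k       = sym (trans (+-cong (zeroʳ _) (zeroʳ _)) (+-identityʳ 0#))
      scale (b ∷ q) zero    = D-* a b
      scale (b ∷ q) (suc k) = scale q k

      shift : ∀ k → coefficient (D 0# ∷ List.map D (p *ₚ q)) k ≈
                    coefficient (0# ∷ List.map D p *ₚ q) k + coefficient (0# ∷ p *ₚ List.map D q) k
      -- The `0#` that multiplication puts in front is itself hit by `List.map D`.
      shift zero    = trans D-0 (sym (+-identityʳ 0#))
      shift (suc k) = trans (map-* p q k) (coefficient-+ (List.map D p *ₚ q) _ k)

    map-isDerivation : IsDerivation polynomialRing (List.map D)
    map-isDerivation = record
      { D-0 = λ _ → refl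
      ; D-+ = map-+
      ; D-* = map-*
      }

module _ (K : RawRing c ℓ) (K-comm : IsCommutative K) where
  open Multivariate K

  private
    Pₙ : ℕ → CommutativeRing c ℓ
    Pₙ n = polynomials K K-comm n

  partial-isDerivation : ∀ n i → IsDerivation (K [X n ]) (partial n i)
  partial-isDerivation (suc n) zero    = derivative-isDerivation (Pₙ n)
  partial-isDerivation (suc n) (suc i) = map-isDerivation (Pₙ n) (partial-isDerivation n i)

  partial-constant : ∀ n i a → RawRing._≈_ (K [X n ]) (partial n i (constant n a)) (RawRing.0# (K [X n ]))
  partial-constant (suc n) zero    a = PolynomialRing.0∷[]≈[] (Pₙ n)
  partial-constant (suc n) (suc i) a zero    = partial-constant n i a
  partial-constant (suc n) (suc i) a (suc k) = CommutativeRing.refl (Pₙ n)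

  partial-1 : ∀ n i → RawRing._≈_ (K [X n ]) (partial n i (RawRing.1# (K [X n ]))) (RawRing.0# (K [X n ]))
  partial-1 (suc n) zero    = PolynomialRing.0∷[]≈[] (Pₙ n)
  partial-1 (suc n) (suc i) zero    = partial-1 n i
  partial-1 (suc n) (suc i) (suc k) = CommutativeRing.refl (Pₙ n)

  partial-var : ∀ n i j → RawRing._≈_ (K [X n ]) (partial n i (var n j)) (Bilinear.unit (K [X n ]) i j)
  partial-var (suc n) zero    zero    = λ { zero → +-identityʳ 1# ; (suc k) → 0∷[]≈[] k }
    where open CommutativeRing (Pₙ n)
          open PolynomialRing (Pₙ n)
  partial-var (suc n) zero    (suc j) = PolynomialRing.0∷[]≈[] (Pₙ n)
  partial-var (suc n) (suc i) zero    = λ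
    { zero          → IsDerivation.D-0 (partial-isDerivation n i)
    ; (suc zero)    → partial-1 n i
    ; (suc (suc k)) → refl }
    where open CommutativeRing (Pₙ n)
  -- `unit` at successors reduces to the same Boolean. Splitting on it exposes the list on the
  -- right, so that coefficient zero becomes the inductive hypothesis.
  partial-var (suc n) (suc i) (suc j) with does (i ≟ j) | partial-var n i j
  ... | true  | eq = λ { zero → eq ; (suc k) → refl }
    where open CommutativeRing (Pₙ n)
  ... | false | eq = λ { zero → eq ; (suc k) → refl }
    where open CommutativeRing (Pₙ n)

module Gradient (S : CommutativeRing c ℓ) {D : _}
                (D-isDerivation : IsDerivation (CommutativeRing.rawRing S) D) where
  open CommutativeRing S
  open IsDerivation D-isDerivation
  open Bilinear rawRing
  open Matrices rawRing using (Matrix)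
  open Sum +-commutativeMonoid using (sum; sum-cong-≋; ∑-distrib-+)
  open SetoidReasoning setoid

  D-sum : ∀ {n} (f : Vector Carrier n) → D (sum f) ≈ sum (D ∘ f)
  D-sum {zero}  f = D-0
  D-sum {suc n} f = trans (D-+ _ _) (+-congˡ (D-sum (f ∘ suc)))

  D-linear : ∀ {n} (m v : Vector Carrier n) → (∀ j → D (m j) ≈ 0#) →
             D (sum (λ j → m j * v j)) ≈ sum (λ j → m j * D (v j))
  D-linear m v Dm≈0 = trans (D-sum (λ j → m j * v j)) (sum-cong-≋ λ j → begin
    D (m j * v j)                 ≈⟨ D-* _ _ ⟩
    D (m j) * v j + m j * D (v j) ≈⟨ +-congʳ (trans (*-congʳ (Dm≈0 j)) (zeroˡ _)) ⟩
    0# + m j * D (v j)            ≈⟨ +-identityˡ _ ⟩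
    m j * D (v j)                 ∎)

  -- In each term `v i * (M i j * v j)` only the two factors from `v` contribute. For a partial
  -- derivative and the vector of variables, `D ∘ v` is a standard basis vector.
  D-bilinear : ∀ {n} (M : Matrix n) (v : Vector Carrier n) → (∀ i j → D (M i j) ≈ 0#) →
               D (bilinear M v v) ≈ bilinear M (D ∘ v) v + bilinear M v (D ∘ v)
  D-bilinear M v DM≈0 = begin
    D (sum (λ i → v i * sum (λ j → M i j * v j)))
      ≈⟨ D-sum (λ i → v i * sum (λ j → M i j * v j)) ⟩
    sum (λ i → D (v i * sum (λ j → M i j * v j)))
      ≈⟨ sum-cong-≋ (λ i → trans (D-* _ _) (+-congˡ (*-congˡ (D-linear (M i) v (DM≈0 i))))) ⟩
    sum (λ i → D (v i) * sum (λ j → M i j * v j) + v i * sum (λ j → M i j * D (v j)))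
      ≈⟨ ∑-distrib-+ (λ i → D (v i) * sum (λ j → M i j * v j)) _ ⟩
    bilinear M (D ∘ v) v + bilinear M v (D ∘ v)
      ∎

-- The pair (A , B), the form G and the shear over an arbitrary ring

module Cubic (K : RawRing c ℓ) where
  open RawRing K
  open RawSemiringDefs rawSemiring using (_^_; sum)
  open Matrices K using (Matrix)

  infixl 6 _-_
  _-_ : Carrier → Carrier → Carrier
  u - v = u + - v

  -- G is cubic coefficientsG at (x , y , z), with coefficientsG as in Forms below.
  cubic : Vector Carrier 5 → Vector Carrier 3 → Carrier
  cubic k v =
    x ^ 3 - k 0F * (y ^ 2 + y * z + z ^ 2) * x
    - k 1F * (k 2F * y ^ 3 + k 3F * y ^ 2 * z + k 4F * y * z ^ 2 - k 2F * z ^ 3)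
    where
    x = v 0F
    y = v 1F
    z = v 2F

  linear : ∀ {n} → Matrix n → Vector Carrier n → Vector Carrier n
  linear M v i = sum (λ j → M i j * v j)

-- Instantiated at expressions for the identity, at `ℚ` for the given pair and form, and at `ℚ[a,b]`
-- for the canonical matrix. The formulas follow those of `A`, `B`, `δ` and `G` literally, so the
-- instance at `ℚ` agrees with them definitionally.
module Forms (K : RawRing c ℓ) (con : ℚ → RawRing.Carrier K) (a b : RawRing.Carrier K) where
  open RawRing K
  open RawSemiringDefs rawSemiring using (_^_)
  open Matrices K
  open Cubic K using (_-_)

  int : ℕ → Carrier
  int n = con (fromℤ (+ n))

  matrixA matrixB matrixC substitution : Matrix 3
  matrixA = ⟨ ⟨ 0# ∣ 0#  ∣ 1#              ⟩
            ∣ ⟨ 0# ∣ - a ∣ 0#              ⟩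
            ∣ ⟨ 1# ∣ 0#  ∣ - b + int 3 * a ⟩ ⟩
  matrixB = ⟨ ⟨ 0# ∣ 1# ∣ 0#  ⟩
            ∣ ⟨ 1# ∣ b  ∣ 0#  ⟩
            ∣ ⟨ 0# ∣ 0# ∣ - a ⟩ ⟩
  matrixC = matrixA ⊗ (adjugate matrixB ⊗ matrixA)
  substitution = ⟨ ⟨ 1# ∣ con (+ 1 / 3) * b ∣ a - con (+ 1 / 3) * b ⟩
                 ∣ ⟨ 0# ∣ 1#                ∣ 0#                    ⟩
                 ∣ ⟨ 0# ∣ 0#                ∣ 1#                    ⟩ ⟩

  delta : Carrier
  delta = b ^ 2 - int 3 * a * b + int 9 * a ^ 2

  coefficientsG : Vector Carrier 5
  coefficientsG 0F = delta * con (+ 1 / 3)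
  coefficientsG 1F = delta * con (+ 1 / 27)
  coefficientsG 2F = int 3 * a - int 2 * b
  coefficientsG 3F = int 3 * (int 6 * a - b)
  coefficientsG 4F = int 3 * (int 3 * a + b)

-- A relation respecting the ring operations respects everything defined from them.
-- Applied to ⟦ f ⟧ k ≈ ⟦ g ⟧ l this says at once that determinants, adjugates, …
-- commute with homomorphisms and respect equality.
record IsCompatible (K : RawRing c ℓ) (L : RawRing c′ ℓ′)
                    (_~_ : REL (RawRing.Carrier K) (RawRing.Carrier L) r) :
                    Set (c ⊔ c′ ⊔ r) where
  private
    module K = RawRing K
    module L = RawRing L
  infixl 6 _+~_
  infixl 7 _*~_
  infix  8 -~_
  field
    _+~_ : ∀ {x y u v} → x ~ u → y ~ v → (x K.+ y) ~ (u L.+ v)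
    _*~_ : ∀ {x y u v} → x ~ u → y ~ v → (x K.* y) ~ (u L.* v)
    -~_  : ∀ {x u} → x ~ u → (K.- x) ~ (L.- u)
    0~   : K.0# ~ L.0#
    1~   : K.1# ~ L.1#

module Transfer {K : RawRing c ℓ} {L : RawRing c′ ℓ′}
                {_~_ : REL (RawRing.Carrier K) (RawRing.Carrier L) r}
                (~-compatible : IsCompatible K L _~_) where
  open IsCompatible ~-compatible
  private
    module K where
      open RawRing K public
      open RawSemiringDefs rawSemiring using (sum; _^_) public
      open Matrices K public
      open Bilinear K public
      open Cubic K public
    module L where
      open RawRing L public
      open RawSemiringDefs rawSemiring using (sum; _^_) public
      open Matrices L public
      open Bilinear L public
      open Cubic L public

  infixl 6 _-~_
  _-~_ : ∀ {x y u v} → x ~ u → y ~ v → (x K.- y) ~ (u L.- v)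
  x~u -~ y~v = x~u +~ -~ y~v

  infixr 8 _^~_
  _^~_ : ∀ {x u} → x ~ u → ∀ n → (x K.^ n) ~ (u L.^ n)
  x~u ^~ zero  = 1~
  x~u ^~ suc n = x~u *~ (x~u ^~ n)

  sum~ : ∀ {n} {f : Vector K.Carrier n} {g : Vector L.Carrier n} →
         (∀ i → f i ~ g i) → K.sum f ~ L.sum g
  sum~ {zero}  f~g = 0~
  sum~ {suc n} f~g = f~g zero +~ sum~ (λ i → f~g (suc i))

  infix 4 _≈ᴹ_
  _≈ᴹ_ : ∀ {n} → K.Matrix n → L.Matrix n → Set _
  M ≈ᴹ N = ∀ i j → M i j ~ N i j

  ⊗~ : ∀ {n} (M N : K.Matrix n) (P Q : L.Matrix n) → M ≈ᴹ P → N ≈ᴹ Q → (M K.⊗ N) ≈ᴹ (P L.⊗ Q)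
  ⊗~ M N P Q M~P N~Q i j = sum~ (λ k → M~P i k *~ N~Q k j)

  sign~ : ∀ {n} (i j : Fin n) → K.sign i j ~ L.sign i j
  sign~ i j = (-~ 1~) ^~ (toℕ i ℕ.+ toℕ j)

  det~ : ∀ {n} (M : K.Matrix n) (N : L.Matrix n) → M ≈ᴹ N → K.det M ~ L.det N
  det~ {zero}  M N M~N = 1~
  det~ {suc n} M N M~N = sum~ λ j →
    sign~ {suc n} zero j *~ (M~N zero j *~ det~ (K.minor M zero j) (L.minor N zero j) (λ k l → M~N _ _))

  adjugate~ : ∀ {n} (M : K.Matrix (suc n)) (N : L.Matrix (suc n)) → M ≈ᴹ N → K.adjugate M ≈ᴹ L.adjugate N
  adjugate~ M N M~N i j =
    sign~ j i *~ det~ (K.minor M j i) (L.minor N j i) (λ k l → M~N _ _)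

  bilinear~ : ∀ {n} (M : K.Matrix n) (N : L.Matrix n) u v u′ v′ → M ≈ᴹ N →
              (∀ i → u i ~ u′ i) → (∀ i → v i ~ v′ i) → K.bilinear M u v ~ L.bilinear N u′ v′
  bilinear~ M N u v u′ v′ M~N u~ v~ = sum~ λ i → u~ i *~ sum~ λ j → M~N i j *~ v~ j

  linear~ : ∀ {n} (M : K.Matrix n) (N : L.Matrix n) v v′ → M ≈ᴹ N →
            (∀ i → v i ~ v′ i) → ∀ i → K.linear M v i ~ L.linear N v′ i
  linear~ M N v v′ M~N v~ i = sum~ λ j → M~N i j *~ v~ j

  if~ : ∀ t {x y u v} → x ~ u → y ~ v → (if t then x else y) ~ (if t then u else v)
  if~ true  x~u y~v = x~u
  if~ false x~u y~v = y~v

  unit~ : ∀ {n} (i j : Fin n) → K.unit i j ~ L.unit i j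
  unit~ i j = if~ (does (i ≟ j)) 1~ 0~

  cubic~ : ∀ k v k′ v′ → (∀ i → k i ~ k′ i) → (∀ i → v i ~ v′ i) → K.cubic k v ~ L.cubic k′ v′
  cubic~ k v k′ v′ k~ v~ =
    x~ ^~ 3 -~ k~ 0F *~ (y~ ^~ 2 +~ y~ *~ z~ +~ z~ ^~ 2) *~ x~
    -~ k~ 1F *~ (k~ 2F *~ y~ ^~ 3 +~ k~ 3F *~ y~ ^~ 2 *~ z~ +~ k~ 4F *~ y~ *~ z~ ^~ 2 -~ k~ 2F *~ z~ ^~ 3)
    where
    x~ = v~ 0F
    y~ = v~ 1F
    z~ = v~ 2F

  module FormsTransfer
    (conᴷ : ℚ → K.Carrier) (conᴸ : ℚ → L.Carrier) (con~ : ∀ q → conᴷ q ~ conᴸ q)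
    (a b : K.Carrier) (a′ b′ : L.Carrier) (a~ : a ~ a′) (b~ : b ~ b′) where
    private
      module FK = Forms K conᴷ a b
      module FL = Forms L conᴸ a′ b′

      int~ : ∀ n → FK.int n ~ FL.int n
      int~ n = con~ (fromℤ (+ n))

    matrixA~ : FK.matrixA ≈ᴹ FL.matrixA
    matrixA~ 0F 0F = 0~
    matrixA~ 0F 1F = 0~
    matrixA~ 0F 2F = 1~
    matrixA~ 1F 0F = 0~
    matrixA~ 1F 1F = -~ a~
    matrixA~ 1F 2F = 0~
    matrixA~ 2F 0F = 1~
    matrixA~ 2F 1F = 0~
    matrixA~ 2F 2F = -~ b~ +~ int~ 3 *~ a~

    matrixB~ : FK.matrixB ≈ᴹ FL.matrixB
    matrixB~ 0F 0F = 0~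
    matrixB~ 0F 1F = 1~
    matrixB~ 0F 2F = 0~
    matrixB~ 1F 0F = 1~
    matrixB~ 1F 1F = b~
    matrixB~ 1F 2F = 0~
    matrixB~ 2F 0F = 0~
    matrixB~ 2F 1F = 0~
    matrixB~ 2F 2F = -~ a~

    matrixC~ : FK.matrixC ≈ᴹ FL.matrixC
    matrixC~ = ⊗~ FK.matrixA _ FL.matrixA _ matrixA~
      (⊗~ (K.adjugate FK.matrixB) FK.matrixA (L.adjugate FL.matrixB) FL.matrixA
        (adjugate~ FK.matrixB FL.matrixB matrixB~) matrixA~)

    substitution~ : FK.substitution ≈ᴹ FL.substitution
    substitution~ 0F 0F = 1~
    substitution~ 0F 1F = con~ _ *~ b~
    substitution~ 0F 2F = a~ -~ con~ _ *~ b~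
    substitution~ 1F 0F = 0~
    substitution~ 1F 1F = 1~
    substitution~ 1F 2F = 0~
    substitution~ 2F 0F = 0~
    substitution~ 2F 1F = 0~
    substitution~ 2F 2F = 1~

    delta~ : FK.delta ~ FL.delta
    delta~ = b~ ^~ 2 -~ int~ 3 *~ a~ *~ b~ +~ int~ 9 *~ a~ ^~ 2

    coefficientsG~ : ∀ i → FK.coefficientsG i ~ FL.coefficientsG i
    coefficientsG~ 0F = delta~ *~ con~ _
    coefficientsG~ 1F = delta~ *~ con~ _
    coefficientsG~ 2F = int~ 3 *~ a~ -~ int~ 2 *~ b~
    coefficientsG~ 3F = int~ 3 *~ (int~ 6 *~ a~ -~ b~)
    coefficientsG~ 4F = int~ 3 *~ (int~ 3 *~ a~ +~ b~)

-- Interpretation of expressions, embedding of constants, evaluation and the identity are the maps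
-- inserted below. With the identity on both sides this becomes plain congruence.
fibre-compatible : (S : CommutativeRing s t) {K : RawRing c ℓ} {L : RawRing c′ ℓ′}
                   (f : K ⟶ S) (g : L ⟶ S) →
                   IsCompatible K L (λ k l → CommutativeRing._≈_ S (⟦ f ⟧ k) (⟦ g ⟧ l))
fibre-compatible S f g = record
  { _+~_ = λ p q → trans (+-homo f _ _) (trans (+-cong p q) (sym (+-homo g _ _)))
  ; _*~_ = λ p q → trans (*-homo f _ _) (trans (*-cong p q) (sym (*-homo g _ _)))
  ; -~_  = λ p → trans (-‿homo f _) (trans (-‿cong p) (sym (-‿homo g _)))
  ; 0~   = trans (0-homo f) (sym (0-homo g))
  ; 1~   = trans (1-homo f) (sym (1-homo g))
  }
  where open CommutativeRing S

id-⟶ : (S : CommutativeRing s t) → CommutativeRing.rawRing S ⟶ S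
id-⟶ S = -raw-almostCommutative⟶ (fromCommutativeRing S)

-- The identity in ℚ[a,b,x,y,z]

module Syntax (S : CommutativeRing s t) (φ : +-*-rawRing ⟶ S) where
  open CommutativeRing S using (_≈_; refl; reflexive)

  -- Lets the solver recognise vanishing coefficients, so that cancelled terms disappear from normal
  -- forms.
  ≟ℚ : ∀ p q → Maybe (⟦ φ ⟧ p ≈ ⟦ φ ⟧ q)
  ≟ℚ p q with p ℚ.≟ q
  ... | yes p≡q = just (reflexive (cong ⟦ φ ⟧ p≡q))
  ... | no  _   = nothing

  module Solver = RingSolver +-*-rawRing (fromCommutativeRing S) φ ≟ℚ
  open Solver using (con; _:+_; _:*_; :-_; prove; Env) renaming (Polynomial to Expr) public

  exprRing : ℕ → RawRing _ _
  exprRing n = record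
    { Carrier = Expr n
    ; _≈_     = _≡_
    ; _+_     = _:+_
    ; _*_     = _:*_
    ; -_      = :-_
    ; 0#      = con 0ℚ
    ; 1#      = con 1ℚ
    }

  interpretation : ∀ {n} → Env n → exprRing n ⟶ S
  interpretation ρ = record
    { ⟦_⟧    = λ e → Solver.⟦ e ⟧ ρ
    ; +-homo = λ _ _ → refl
    ; *-homo = λ _ _ → refl
    ; -‿homo = λ _ → refl
    ; 0-homo = 0-homo φ
    ; 1-homo = 1-homo φ
    }

  α β : Expr 5
  α = Solver.var 3F
  β = Solver.var 4F

  X : Vector (Expr 5) 3
  X = ⟨ Solver.var 0F ∣ Solver.var 1F ∣ Solver.var 2F ⟩

  open RawRing (exprRing 5) using (_+_; _*_)
  open Bilinear (exprRing 5)
  open Cubic (exprRing 5)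
  open Matrices (exprRing 5) using (Matrix; det)
  open Forms (exprRing 5) con α β

  gradients : Vector (Matrix 3) 3 → Matrix 3
  gradients M i j = bilinear (M i) (unit j) X + bilinear (M i) X (unit j)

  substitutedCubic scaledJacobian : Expr 5
  substitutedCubic = cubic coefficientsG (linear substitution X)
  scaledJacobian = con (+ 1 / 8) * det (gradients ⟨ matrixA ∣ matrixB ∣ matrixC ⟩)

  -- `S` and `φ` are variables here, so `refl` compares normal forms with computed rational
  -- coefficients and unfolds no concrete ring.
  substitutedCubic≈scaledJacobian : ∀ ρ → Solver.⟦ substitutedCubic ⟧ ρ ≈ Solver.⟦ scaledJacobian ⟧ ρ
  substitutedCubic≈scaledJacobian ρ = prove ρ substitutedCubic scaledJacobian refl

-- `ℚ[x,y,z]` is replaced by an arbitrary ring with the data that the argument uses: constants `φ`,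
-- a point `v` in place of the variables, a substitution `σ` fixing constants, and derivations `∂`
-- dual to `v`.
module Covariant (S : CommutativeRing s t) (φ : +-*-rawRing ⟶ S) (a b : ℚ)
                 (v : Vector (CommutativeRing.Carrier S) 3) where
  open CommutativeRing S hiding (_-_)
  open Cubic rawRing
  open Bilinear rawRing
  open Matrices rawRing using (Matrix; det)
  open Syntax S φ
  private
    module F = Forms +-*-rawRing id a b
    module E where
      open RawRing (exprRing 5) public
      open Bilinear (exprRing 5) public
      open Cubic (exprRing 5) public
      open Matrices (exprRing 5) using (Matrix) public
      open Forms (exprRing 5) con α β public

    ρ : Env 5
    ρ = v 0F ∷ v 1F ∷ v 2F ∷ ⟦ φ ⟧ a ∷ ⟦ φ ⟧ b ∷ []

    value : Expr 5 → Carrier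
    value = ⟦ interpretation ρ ⟧

    -- `Scalars` compares an expression with a rational sent through `φ`, `Values` with an element
    -- of `S` itself.
    module Scalars = Transfer (fibre-compatible S (interpretation ρ) φ)
    module Values  = Transfer (fibre-compatible S (interpretation ρ) (id-⟶ S))

    X~ : ∀ i → value (X i) ≈ v i
    X~ 0F = refl
    X~ 1F = refl
    X~ 2F = refl

    module ScalarForms = Scalars.FormsTransfer con id (λ _ → refl) α β a b refl refl

  scalars : ∀ {n} → Matrices.Matrix +-*-rawRing n → Matrix n
  scalars M i j = ⟦ φ ⟧ (M i j)

  quadratic : Matrixℚ 3 → Carrier
  quadratic M = bilinear (scalars M) v v

  module _ (σ : rawRing ⟶ S) (σφ≈φ : ∀ q → ⟦ σ ⟧ (⟦ φ ⟧ q) ≈ ⟦ φ ⟧ q)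
           (N : Matrixℚ 3) (N≡ : ∀ i j → N i j ≡ F.substitution i j)
           (σv≈ : ∀ i → ⟦ σ ⟧ (v i) ≈ linear (scalars N) v i) where

    -- A homomorphism moves inside the cubic, so only its action on coefficients, which it fixes,
    -- and on `v`, which it sends to `N v`, matters.
    value-cubic : value substitutedCubic ≈ ⟦ σ ⟧ (cubic (λ i → ⟦ φ ⟧ (F.coefficientsG i)) v)
    value-cubic =
      Transfer.cubic~ (fibre-compatible S (interpretation ρ) σ)
        E.coefficientsG (E.linear E.substitution X) (λ i → ⟦ φ ⟧ (F.coefficientsG i)) v
        (λ i → trans (ScalarForms.coefficientsG~ i) (sym (σφ≈φ _)))
        (λ i → trans (Values.linear~ E.substitution (scalars N) X v N~ X~ i) (sym (σv≈ i)))
      where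
      N~ : ∀ i j → value (E.substitution i j) ≈ scalars N i j
      N~ i j = trans (ScalarForms.substitution~ i j) (reflexive (cong ⟦ φ ⟧ (≡.sym (N≡ i j))))

    module _ (∂ : Fin 3 → Carrier → Carrier) (∂-isDerivation : ∀ j → IsDerivation rawRing (∂ j))
             (∂φ≈0 : ∀ j q → ∂ j (⟦ φ ⟧ q) ≈ 0#) (∂v≈unit : ∀ j i → ∂ j (v i) ≈ unit j i) where

      value-gradient : ∀ (Mₑ : E.Matrix 3) (M : Matrixℚ 3) → (∀ i j → value (Mₑ i j) ≈ scalars M i j) →
        ∀ j → value (E.bilinear Mₑ (E.unit j) X E.+ E.bilinear Mₑ X (E.unit j)) ≈ ∂ j (quadratic M)
      value-gradient Mₑ M M~ j = trans
        (+-cong (Values.bilinear~ Mₑ (scalars M) (E.unit j) X ∂v v M~ unit~ X~)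
                (Values.bilinear~ Mₑ (scalars M) X (E.unit j) v ∂v M~ X~ unit~))
        (sym (Gradient.D-bilinear S (∂-isDerivation j) (scalars M) v (λ i k → ∂φ≈0 j (M i k))))
        where
        ∂v : Vector Carrier 3
        ∂v i = ∂ j (v i)

        unit~ : ∀ i → value (E.unit j i) ≈ ∂v i
        unit~ i = trans (Values.unit~ j i) (sym (∂v≈unit j i))

      -- f, g and h stay variables so that no concrete polynomial is normalised when
      -- this is applied to the quadratic forms of Defs; likewise N.
      value-jacobian : ∀ {f g h} →
        f ≡ quadratic F.matrixA → g ≡ quadratic F.matrixB → h ≡ quadratic F.matrixC →
        value scaledJacobian ≈ ⟦ φ ⟧ (+ 1 / 8) * det (λ i j → ∂ j (⟨ f ∣ g ∣ h ⟩ i))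
      value-jacobian ≡.refl ≡.refl ≡.refl = *-congˡ
        (Values.det~ (gradients ⟨ E.matrixA ∣ E.matrixB ∣ E.matrixC ⟩)
          (λ i j → ∂ j (⟨ quadratic F.matrixA ∣ quadratic F.matrixB ∣ quadratic F.matrixC ⟩ i)) λ
          { 0F → value-gradient E.matrixA F.matrixA ScalarForms.matrixA~
          ; 1F → value-gradient E.matrixB F.matrixB ScalarForms.matrixB~
          ; 2F → value-gradient E.matrixC F.matrixC ScalarForms.matrixC~
          })

      cubic≈jacobian : ∀ {f g h} →
        f ≡ quadratic F.matrixA → g ≡ quadratic F.matrixB → h ≡ quadratic F.matrixC →
        ⟦ σ ⟧ (cubic (λ i → ⟦ φ ⟧ (F.coefficientsG i)) v) ≈
        ⟦ φ ⟧ (+ 1 / 8) * det (λ i j → ∂ j (⟨ f ∣ g ∣ h ⟩ i))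
      cubic≈jacobian f≡ g≡ h≡ =
        trans (sym value-cubic) (trans (substitutedCubic≈scaledJacobian ρ) (value-jacobian f≡ g≡ h≡))

-- Specialisation to ℚ[x,y,z]

open Defs using
  ( _⊗ℚ_; adjugateℚ; AllCoefficients; const; constant; evaluate; partial
  ; quadraticForm; specialise; var)

ℚ-isCommutative : IsCommutative +-*-rawRing
ℚ-isCommutative = ℚ.+-*-isCommutativeRing

ℚ-ring ℚ[x,y,z]-ring : CommutativeRing 0ℓ 0ℓ
ℚ-ring        = bundle +-*-rawRing ℚ-isCommutative
ℚ[x,y,z]-ring = polynomials +-*-rawRing ℚ-isCommutative 3

module Parametric = Forms (+-*-rawRing [X 2 ]) (constant 2) (var 2 0F) (var 2 1F)

-- Integrality of the shear over `ℤ[⅓]`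

0∈ℤ[⅓] : 0ℚ ∈ℤ[⅓]
0∈ℤ[⅓] = + 0 , 0 , ≡.refl

1∈ℤ[⅓] : 1ℚ ∈ℤ[⅓]
1∈ℤ[⅓] = + 1 , 0 , ≡.refl

-- The entries compute to nested lists, powers of `a` outside and powers of `b` inside: `b/3` is
-- `(0 ∷ ⅓ ∷ []) ∷ []`, and `a − b/3` has a second row `1 ∷ []` for the term in `a`.
parametric-coefficients : ∀ i j → AllCoefficients _∈ℤ[⅓] 2 (Parametric.substitution i j)
parametric-coefficients = λ
  { 0F 0F → (1∈ℤ[⅓] ∷ []) ∷ []
  ; 0F 1F → (0∈ℤ[⅓] ∷ ⅓∈ℤ[⅓] ∷ []) ∷ []
  ; 0F 2F → (0∈ℤ[⅓] ∷ -⅓∈ℤ[⅓] ∷ []) ∷ (1∈ℤ[⅓] ∷ []) ∷ []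
  ; 1F 0F → []
  ; 1F 1F → (1∈ℤ[⅓] ∷ []) ∷ []
  ; 1F 2F → []
  ; 2F 0F → []
  ; 2F 1F → []
  ; 2F 2F → (1∈ℤ[⅓] ∷ []) ∷ []
  }
  where
  ⅓∈ℤ[⅓] : (+ 1 / 3) ∈ℤ[⅓]
  ⅓∈ℤ[⅓] = + 1 , 1 , ≡.refl

  -⅓∈ℤ[⅓] : (ℚ.- (+ 1 / 3)) ∈ℤ[⅓]
  -⅓∈ℤ[⅓] = ℤ.- + 1 , 1 , ≡.refl

-- Addition in `ℚ` normalises the fraction with numerator `m * 1 + n * 1` and denominator `1`; a
-- rational is recovered from its own numerator and denominator.
fromℤ-homo-+ : ∀ m n → fromℤ (m ℤ.+ n) ≡ fromℤ m ℚ.+ fromℤ n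
fromℤ-homo-+ m n = ≡.sym (≡.trans
  (cong (_/ 1) (≡.cong₂ ℤ._+_ (ℤ.*-identityʳ m) (ℤ.*-identityʳ n)))
  (ℚ.↥p/↧p≡p (fromℤ (m ℤ.+ n))))

fromℤ-homo-* : ∀ m n → fromℤ (m ℤ.* n) ≡ fromℤ m ℚ.* fromℤ n
fromℤ-homo-* m n = ≡.sym (ℚ.↥p/↧p≡p (fromℤ (m ℤ.* n)))

-- Negation in `ℚ` matches on the numerator, hence the cases.
fromℤ-homo‿- : ∀ m → fromℤ (ℤ.- m) ≡ ℚ.- fromℤ m
fromℤ-homo‿- (+ zero)   = ≡.refl
fromℤ-homo‿- ℤ.+[1+ n ] = ≡.refl
fromℤ-homo‿- ℤ.-[1+ n ] = ≡.refl

substitution∈ℤ[⅓] : ∀ a b i j → Forms.substitution +-*-rawRing id (fromℤ a) (fromℤ b) i j ∈ℤ[⅓]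
substitution∈ℤ[⅓] a b = λ
  { 0F 0F → 1∈ℤ[⅓]
  ; 0F 1F → b , 1 , ℚ.*-comm (+ 1 / 3) (fromℤ b)
  -- Over the common denominator, `a − b/3 = (3a − b)/3`.
  ; 0F 2F → + 3 ℤ.* a ℤ.+ ℤ.- b , 1 , a-⅓b
  ; 1F 0F → 0∈ℤ[⅓]
  ; 1F 1F → 1∈ℤ[⅓]
  ; 1F 2F → 0∈ℤ[⅓]
  ; 2F 0F → 0∈ℤ[⅓]
  ; 2F 1F → 0∈ℤ[⅓]
  ; 2F 2F → 1∈ℤ[⅓]
  }
  where
  open ≡.≡-Reasoning
  open +-*-Solver using (solve; con; _:+_; _:*_; :-_; _:=_)

  ⅓ = + 1 / 3

  a-⅓b : fromℤ a ℚ.+ ℚ.- (⅓ ℚ.* fromℤ b) ≡ fromℤ (+ 3 ℤ.* a ℤ.+ ℤ.- b) ℚ.* ⅓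
  a-⅓b = begin
    fromℤ a ℚ.+ ℚ.- (⅓ ℚ.* fromℤ b)
      ≡⟨ solve 2 (λ u v → u :+ (:- (con ⅓ :* v)) := (con (fromℤ (+ 3)) :* u :+ (:- v)) :* con ⅓)
           ≡.refl (fromℤ a) (fromℤ b) ⟩
    (fromℤ (+ 3) ℚ.* fromℤ a ℚ.+ ℚ.- fromℤ b) ℚ.* ⅓
      ≡⟨ cong (ℚ._* ⅓) (≡.cong₂ ℚ._+_ (fromℤ-homo-* (+ 3) a) (fromℤ-homo‿- b)) ⟨
    (fromℤ (+ 3 ℤ.* a) ℚ.+ fromℤ (ℤ.- b)) ℚ.* ⅓
      ≡⟨ cong (ℚ._* ⅓) (fromℤ-homo-+ (+ 3 ℤ.* a) (ℤ.- b)) ⟨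
    fromℤ (+ 3 ℤ.* a ℤ.+ ℤ.- b) ℚ.* ⅓
      ∎

module _ (a b : ℚ) where
  private
    module F = Forms +-*-rawRing id a b

    point : Vector ℚ 2
    point = a Vector.∷ b Vector.∷ Vector.[]

    evaluate-at-point : (+-*-rawRing [X 2 ]) ⟶ ℚ-ring
    evaluate-at-point = evaluate-⟶ +-*-rawRing ℚ-ring (id-⟶ ℚ-ring) 2 point

  -- Evaluation at `(a , b)` is a homomorphism sending the two indeterminates to `a` and `b`, so it
  -- carries the formula over `ℚ[a,b]` to the formula over `ℚ`.
  evaluate-parametric : ∀ i j →
    evaluate +-*-rawRing id 2 point (Parametric.substitution i j) ≡ F.substitution i j
  evaluate-parametric =
    Transfer.FormsTransfer.substitution~
      (fibre-compatible ℚ-ring evaluate-at-point (id-⟶ ℚ-ring))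
      (constant 2) id
      (evaluate-constant ℚ-ring (id-⟶ ℚ-ring) 2 point)
      (var 2 0F) (var 2 1F) a b
      (evaluate-var ℚ-ring (id-⟶ ℚ-ring) 2 point 0F)
      (evaluate-var ℚ-ring (id-⟶ ℚ-ring) 2 point 1F)

  module _ (N : Matrixℚ 3) (N≡ : ∀ i j → N i j ≡ F.substitution i j) where

    det-substitution : detℚ N ≡ 1ℚ
    det-substitution = ≡.trans
      -- `N≡` is only a pointwise equality of functions, so the determinant needs its own
      -- congruence.
      (Transfer.det~ (fibre-compatible ℚ-ring (id-⟶ ℚ-ring) (id-⟶ ℚ-ring)) N F.substitution N≡)
      (prove (a ∷ b ∷ []) (Matrices.det (exprRing 2) E.substitution) (con 1ℚ) ≡.refl)
      where
      open Syntax ℚ-ring (id-⟶ ℚ-ring)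
      module E = Forms (exprRing 2) con (Solver.var 0F) (Solver.var 1F)

    open CommutativeRing ℚ[x,y,z]-ring using (_≈_)

    private
      const-⟶ : +-*-rawRing ⟶ ℚ[x,y,z]-ring
      const-⟶ = constant-⟶ +-*-rawRing ℚ-isCommutative 3

      substitute-⟶ : ℚ[x,y,z] ⟶ ℚ[x,y,z]-ring
      substitute-⟶ = evaluate-⟶ +-*-rawRing ℚ[x,y,z]-ring const-⟶ 3 (linearForms N)

      -- Stated for a variable `M`, so the two finite sums are compared before any concrete matrix
      -- enters.
      quadraticForm-bilinear : ∀ M →
        quadraticForm M ≡ Bilinear.bilinear ℚ[x,y,z] (λ i j → const (M i j)) (var 3) (var 3)
      quadraticForm-bilinear M = ≡.refl

    substitute-G : substitute N (G a b) ≈ cubicovariant (A a b , B a b)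
    substitute-G = Covariant.cubic≈jacobian ℚ[x,y,z]-ring const-⟶ a b (var 3)
      substitute-⟶
      (evaluate-constant ℚ[x,y,z]-ring const-⟶ 3 (linearForms N))
      N N≡
      (evaluate-var ℚ[x,y,z]-ring const-⟶ 3 (linearForms N))
      (partial 3)
      (partial-isDerivation +-*-rawRing ℚ-isCommutative 3)
      (partial-constant +-*-rawRing ℚ-isCommutative 3)
      (partial-var +-*-rawRing ℚ-isCommutative 3)
      (quadraticForm-bilinear (A a b))
      (quadraticForm-bilinear (B a b))
      (quadraticForm-bilinear (A a b ⊗ℚ (adjugateℚ (B a b) ⊗ℚ A a b)))

theorem1p3 : CanonicallyEquivalent
    (λ a b → G (fromℤ a) (fromℤ b))
    (λ a b → cubicovariant (A (fromℤ a) (fromℤ b) , B (fromℤ a) (fromℤ b)))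
theorem1p3 = Parametric.substitution , parametric-coefficients , λ a b →
  let N : Matrixℚ 3
      N i j = specialise (Parametric.substitution i j) a b

      N≡ : ∀ i j → N i j ≡ Forms.substitution +-*-rawRing id (fromℤ a) (fromℤ b) i j
      N≡ = evaluate-parametric (fromℤ a) (fromℤ b)
  -- Coefficients in `ℤ[⅓]` were settled for the parametric matrix; membership is also owed for each
  -- specialised entry.
  in ( (λ i j → ≡.subst _∈ℤ[⅓] (≡.sym (N≡ i j)) (substitution∈ℤ[⅓] a b i j))
     , det-substitution (fromℤ a) (fromℤ b) N N≡
     ) , substitute-G (fromℤ a) (fromℤ b) N N≡
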